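{- Let $p$ be a prime, and let $H \in \mathbb{N}$ and $m_1, \ldots, m_H \in \mathbb{Z}$. For all sufficiently large $N \in \mathbb{N}$ (i.e., there is $N_0$ depending on $p, H, m_1, \ldots, m_H$ such that for every $N \geq N_0$), there exist sets $A,B \subseteq (\mathbb{Z}/p\mathbb{Z})^N$ such that $$|hA|-|hB|=m_h$$ for each $1 \leq h \leq H$.
   Context: $\mathbb{N}$ denotes the positive integers. For a subset $A$ of an abelian group and $h \in \mathbb{N}$, the $h$-fold iterated sumset is $hA:=\{a_1+\cdots+a_h : a_1,\ldots,a_h \in A\}$ (repetitions allowed). $|X|$ denotes the cardinality of a finite set $X$. -}

module Defs where

open import Algebra.Bundles using (AbelianGroup)
import Algebra.Definitions.RawMonoid as RawMonoidDefinitions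
open import Data.Fin.Base using (Fin; toℕ)
open import Data.Fin.Properties using (toℕ-fromℕ<; toℕ-injective; toℕ<n)
open import Data.List.Base using (length)
import Data.List.Membership.Setoid as SetoidMembership
import Data.List.Relation.Unary.Unique.Setoid as SetoidUnique
open import Data.Nat.Base using (ℕ; NonZero; _+_; _∸_; _%_)
open import Data.Nat.DivMod using (_mod_; m%n<n; m<n⇒m%n≡m; m%n%n≡m%n; n%n≡0; %-distribˡ-+)
open import Data.Nat.Properties using (+-assoc; +-comm; m∸n+n≡m; <⇒≤)
open import Data.Product.Base using (_×_; _,_; ∃-syntax)
open import Data.Vec.Base using (Vec; replicate; map; zipWith)
open import Data.Vec.Properties using (zipWith-assoc; zipWith-comm; zipWith-identityˡ; zipWith-identityʳ; zipWith-inverseˡ; zipWith-inverseʳ)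
open import Function.Bundles using (_⇔_)
open import Level using (0ℓ; _⊔_)
open import Relation.Binary.Bundles using (Setoid)
open import Relation.Binary.PropositionalEquality
  using (_≡_; sym; trans; cong; cong₂; isEquivalence; module ≡-Reasoning)
open import Relation.Unary using (Pred)

-- Fin n as ℤ/nℤ: a residue class is its representative in {0, …, n-1}.
module ℤmod (n : ℕ) .{{_ : NonZero n}} where

  infixl 6 _⊕_

  _⊕_ : Fin n → Fin n → Fin n
  i ⊕ j = (toℕ i + toℕ j) mod n

  𝟘 : Fin n
  𝟘 = 0 mod n

  ⊖_ : Fin n → Fin n
  ⊖ i = (n ∸ toℕ i) mod n

  toℕ-mod : ∀ a → toℕ (a mod n) ≡ a % n
  toℕ-mod a = toℕ-fromℕ< (m%n<n a n)

  mod-cong : ∀ {a b} → a % n ≡ b % n → a mod n ≡ b mod n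
  mod-cong {a} {b} eq =
    toℕ-injective (trans (toℕ-mod a) (trans eq (sym (toℕ-mod b))))

  mod-toℕ : ∀ i → toℕ i mod n ≡ i
  mod-toℕ i = toℕ-injective (trans (toℕ-mod (toℕ i)) (m<n⇒m%n≡m (toℕ<n i)))

  mod-homo-+ : ∀ a b → (a mod n) ⊕ (b mod n) ≡ (a + b) mod n
  mod-homo-+ a b = mod-cong (trans
    (cong (_% n) (cong₂ _+_ (toℕ-mod a) (toℕ-mod b)))
    (sym (%-distribˡ-+ a b n)))

  ⊕-comm : ∀ i j → i ⊕ j ≡ j ⊕ i
  ⊕-comm i j = cong (_mod n) (+-comm (toℕ i) (toℕ j))

  ⊕-assoc : ∀ i j k → (i ⊕ j) ⊕ k ≡ i ⊕ (j ⊕ k)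
  ⊕-assoc i j k = begin
    (i ⊕ j) ⊕ k                      ≡⟨ cong ((i ⊕ j) ⊕_) (mod-toℕ k) ⟨
    (i ⊕ j) ⊕ (toℕ k mod n)          ≡⟨ mod-homo-+ (toℕ i + toℕ j) (toℕ k) ⟩
    (toℕ i + toℕ j + toℕ k) mod n    ≡⟨ cong (_mod n) (+-assoc (toℕ i) (toℕ j) (toℕ k)) ⟩
    (toℕ i + (toℕ j + toℕ k)) mod n  ≡⟨ mod-homo-+ (toℕ i) (toℕ j + toℕ k) ⟨
    (toℕ i mod n) ⊕ (j ⊕ k)          ≡⟨ cong (_⊕ (j ⊕ k)) (mod-toℕ i) ⟩
    i ⊕ (j ⊕ k)                      ∎
    where open ≡-Reasoning

  ⊕-identityˡ : ∀ i → 𝟘 ⊕ i ≡ i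
  ⊕-identityˡ i = begin
    𝟘 ⊕ i              ≡⟨ cong (𝟘 ⊕_) (mod-toℕ i) ⟨
    𝟘 ⊕ (toℕ i mod n)  ≡⟨ mod-homo-+ 0 (toℕ i) ⟩
    toℕ i mod n        ≡⟨ mod-toℕ i ⟩
    i                  ∎
    where open ≡-Reasoning

  ⊕-identityʳ : ∀ i → i ⊕ 𝟘 ≡ i
  ⊕-identityʳ i = trans (⊕-comm i 𝟘) (⊕-identityˡ i)

  ⊖-inverseˡ : ∀ i → (⊖ i) ⊕ i ≡ 𝟘
  ⊖-inverseˡ i = begin
    (⊖ i) ⊕ i                  ≡⟨ cong ((⊖ i) ⊕_) (mod-toℕ i) ⟨
    (⊖ i) ⊕ (toℕ i mod n)      ≡⟨ mod-homo-+ (n ∸ toℕ i) (toℕ i) ⟩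
    (n ∸ toℕ i + toℕ i) mod n  ≡⟨ cong (_mod n) (m∸n+n≡m (<⇒≤ (toℕ<n i))) ⟩
    n mod n                    ≡⟨ mod-cong (trans (sym (m%n%n≡m%n n n)) (cong (_% n) (n%n≡0 n))) ⟩
    𝟘                          ∎
    where open ≡-Reasoning

  ⊖-inverseʳ : ∀ i → i ⊕ (⊖ i) ≡ 𝟘
  ⊖-inverseʳ i = trans (⊕-comm i (⊖ i)) (⊖-inverseˡ i)

infix 8 [ℤ/_]^_

[ℤ/_]^_ : (n N : ℕ) .{{_ : NonZero n}} → AbelianGroup 0ℓ 0ℓ
[ℤ/ n ]^ N = record
  { Carrier = Vec (Fin n) N
  ; _≈_     = _≡_
  ; _∙_     = zipWith _⊕_
  ; ε       = replicate N 𝟘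
  ; _⁻¹     = map ⊖_
  ; isAbelianGroup = record
    { isGroup = record
      { isMonoid = record
        { isSemigroup = record
          { isMagma = record
            { isEquivalence = isEquivalence
            ; ∙-cong        = cong₂ (zipWith _⊕_)
            }
          ; assoc = zipWith-assoc ⊕-assoc
          }
        ; identity = zipWith-identityˡ ⊕-identityˡ , zipWith-identityʳ ⊕-identityʳ
        }
      ; inverse = zipWith-inverseˡ ⊖-inverseˡ , zipWith-inverseʳ ⊖-inverseʳ
      ; ⁻¹-cong = cong (map ⊖_)
      }
    ; comm = zipWith-comm ⊕-comm
    }
  }
  where open ℤmod n

module _ {c ℓ} (G : AbelianGroup c ℓ) where

  open AbelianGroup G using (Carrier; _≈_; rawMonoid)
  open RawMonoidDefinitions rawMonoid using (sum)

  Sumset : ∀ {p} → ℕ → Pred Carrier p → Pred Carrier (c ⊔ ℓ ⊔ p)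
  Sumset h A x = ∃[ a ] ((i : Fin h) → A (a i)) × x ≈ sum a

module _ {c ℓ} (S : Setoid c ℓ) where

  open Setoid S using (Carrier)
  open SetoidMembership S using (_∈_)
  open SetoidUnique S using (Unique)

  -- The subset P is finite with exactly k elements (up to the setoid
  -- equality): some duplicate-free list of length k enumerates it.
  HasCardinality : ∀ {p} → Pred Carrier p → ℕ → Set (c ⊔ ℓ ⊔ p)
  HasCardinality P k =
    ∃[ xs ] Unique xs × (∀ x → P x ⇔ x ∈ xs) × length xs ≡ k

module Submission where

-- Let F = ℤ/pℤ and L = F².  A point of Fᴺ is (t , e , (ℓᵢ , cᵢ)ᵢ) with t ∈ Fʳ, e and cᵢ ∈ F, ℓᵢ ∈ L,
-- and its weight is the number of nonzero markers among e and the cᵢ.  Weight is subadditive, with equality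
-- only for disjoint supports.  The sets used consist of all points of weight 0 and some points of weight 1
-- (the "edges"), chosen so that the h-fold sumset is {weight < h} ∪ {edges of weight h}.  An edge with e = 1
-- is a point outside a "hole" prescribed by ψ t.  A hole of type j contains no point with more than j nonzero
-- cᵢ and exactly one with j of them, so it removes one point from the (j+1)-fold sumset, none from the higher
-- ones, and a fixed number from each lower one.  Holes at different t act independently, so realising the mᵢ
-- as differences means solving a unitriangular system over ℤ; its positive part gives the holes of B, its
-- negative part those of A.

open import Defs
open import Algebra.Bundles using (AbelianGroup)
open import Algebra.Properties.CommutativeSemigroup using (interchange)
open import Data.Bool.Base using (Bool; true; false)
open import Data.Empty using (⊥)
open import Data.Fin.Base using (Fin; zero; suc; toℕ; fromℕ<)
import Data.Fin.Properties as Fin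
import Data.Integer.Base as ℤ
open import Data.Integer.Base using (ℤ; +_; -[1+_]; _-_)
import Data.Integer.Properties as ℤ
open import Data.Integer.Solver using (module +-*-Solver)
open import Data.List.Base
  using (List; []; _∷_; _++_; map; filter; length; allFin; tabulate; replicate; cartesianProduct; cartesianProductWith)
open import Data.List.Membership.Propositional using (_∈_)
open import Data.List.Membership.Propositional.Properties
  using (∈-allFin; ∈-tabulate⁻; ∈-map⁺; ∈-map⁻; ∈-filter⁺; ∈-filter⁻; ∈-cartesianProduct⁺; ∈-cartesianProductWith⁺)
open import Data.List.Properties using (length-map; map-++; map-∘)
open import Data.List.Relation.Unary.All using (All; []; _∷_)
import Data.List.Relation.Unary.All as All
import Data.List.Relation.Unary.All.Properties as All
open import Data.List.Relation.Unary.AllPairs using ([]; _∷_)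
open import Data.List.Relation.Unary.Any using (here; there)
open import Data.List.Relation.Unary.Unique.Propositional using (Unique)
import Data.List.Relation.Unary.Unique.Propositional.Properties as Unique
open import Data.Maybe.Base using (Maybe; just; nothing)
open import Data.Nat.Base using (ℕ; zero; suc; _+_; _*_; NonZero; _≤_; _<_; z≤n; s≤s; s<s⁻¹)
open import Data.Nat.ListAction using (sum)
open import Data.Nat.ListAction.Properties using (sum-++)
open import Data.Nat.Primality using (Prime; prime⇒nonZero)
import Data.Nat.Properties as ℕ
open import Data.Product.Base using (_×_; _,_; proj₁; proj₂; ∃-syntax; Σ-syntax)
open import Data.Sum.Base using (_⊎_; inj₁; inj₂)
open import Data.Unit.Base using (⊤; tt)
import Data.Vec.Base as Vec
open import Data.Vec.Base using (Vec; []; _∷_; zipWith; take; drop)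
import Data.Vec.Functional as Vector
import Data.Vec.Properties as Vec
open import Function.Base using (_∘_; id; const)
open import Function.Bundles using (_⇔_; mk⇔; Equivalence)
open import Level using (Level; 0ℓ)
open import Relation.Binary.PropositionalEquality
  using (_≡_; _≢_; refl; sym; trans; cong; cong₂; subst; subst₂; setoid; module ≡-Reasoning)
open import Relation.Nullary using (¬_; Dec; yes; no; contradiction; _×-dec_; _⊎-dec_; ¬?)
open import Relation.Unary using (Pred; Decidable)

-- Counting in lists, products and vectors.

private
  variable
    a b ℓ : Level
    A : Set a
    B : Set b

count : {P : Pred A ℓ} → Decidable P → List A → ℕ
count P? xs = length (filter P? xs)

count-⊎ : ∀ {ℓ₁ ℓ₂ ℓ₃} {P : Pred A ℓ₁} {Q : Pred A ℓ₂} {R : Pred A ℓ₃}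
          (P? : Decidable P) (Q? : Decidable Q) (R? : Decidable R) →
          (∀ x → P x → Q x ⊎ R x) → (∀ x → Q x → P x) → (∀ x → R x → P x) →
          (∀ x → Q x → ¬ R x) → ∀ xs → count P? xs ≡ count Q? xs + count R? xs
count-⊎ P? Q? R? P⇒Q⊎R Q⇒P R⇒P Q∩R=∅ [] = refl
count-⊎ P? Q? R? P⇒Q⊎R Q⇒P R⇒P Q∩R=∅ (x ∷ xs)
  with ih ← count-⊎ P? Q? R? P⇒Q⊎R Q⇒P R⇒P Q∩R=∅ xs | P? x | Q? x | R? x
... | _     | yes q | yes r = contradiction r (Q∩R=∅ x q)
... | yes _ | yes _ | no  _ = cong suc ih
... | yes _ | no  _ | yes _ = trans (cong suc ih) (sym (ℕ.+-suc _ _))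
... | no ¬p | yes q | no  _ = contradiction (Q⇒P x q) ¬p
... | no ¬p | no  _ | yes r = contradiction (R⇒P x r) ¬p
... | no  _ | no  _ | no  _ = ih
... | yes p | no ¬q | no ¬r with P⇒Q⊎R x p
...   | inj₁ q = contradiction q ¬q
...   | inj₂ r = contradiction r ¬r

count-++ : {P : Pred A ℓ} (P? : Decidable P) → ∀ xs ys → count P? (xs ++ ys) ≡ count P? xs + count P? ys
count-++ P? [] ys = refl
count-++ P? (x ∷ xs) ys with P? x
... | yes _ = cong suc (count-++ P? xs ys)
... | no  _ = count-++ P? xs ys

count-map : {P : Pred B ℓ} (P? : Decidable P) (f : A → B) → ∀ xs → count P? (map f xs) ≡ count (P? ∘ f) xs
count-map P? f [] = refl
count-map P? f (x ∷ xs) with P? (f x)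
... | yes _ = cong suc (count-map P? f xs)
... | no  _ = count-map P? f xs

count-cartesianProduct : {P : Pred (A × B) ℓ} (P? : Decidable P) → ∀ xs ys →
  count P? (cartesianProduct xs ys) ≡ sum (map (λ x → count (λ y → P? (x , y)) ys) xs)
count-cartesianProduct P? [] ys = refl
count-cartesianProduct P? (x ∷ xs) ys = trans
  (count-++ P? (map (x ,_) ys) (cartesianProduct xs ys))
  (cong₂ _+_ (count-map P? (x ,_) ys) (count-cartesianProduct P? xs ys))

count-none : {P : Pred A ℓ} (P? : Decidable P) → (∀ x → ¬ P x) → ∀ xs → count P? xs ≡ 0
count-none P? ¬P [] = refl
count-none P? ¬P (x ∷ xs) with P? x
... | yes p = contradiction p (¬P x)
... | no  _ = count-none P? ¬P xs

module _ {A : Set a} where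

  sum-zero : (g : A → ℕ) → ∀ xs → (∀ x → x ∈ xs → g x ≡ 0) → sum (map g xs) ≡ 0
  sum-zero g []       g≡0 = refl
  sum-zero g (x ∷ xs) g≡0 = cong₂ _+_ (g≡0 x (here refl)) (sum-zero g xs (λ y → g≡0 y ∘ there))

  sum-single : (g : A → ℕ) {x₀ : A} → ∀ {xs} → Unique xs → x₀ ∈ xs →
               (∀ x → x ∈ xs → x ≢ x₀ → g x ≡ 0) → sum (map g xs) ≡ g x₀
  sum-single g {xs = x ∷ xs} (x∉xs ∷ _) (here refl) g≡0 =
    trans (cong (λ k → g x + k)
            (sum-zero g xs (λ y y∈xs → g≡0 y (there y∈xs) (λ eq → All.lookup x∉xs y∈xs (sym eq)))))
          (ℕ.+-identityʳ (g x))
  sum-single g {xs = x ∷ xs} (x∉xs ∷ xs!) (there x₀∈xs) g≡0 =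
    cong₂ _+_ (g≡0 x (here refl) (All.lookup x∉xs x₀∈xs))
              (sum-single g xs! x₀∈xs (λ y → g≡0 y ∘ there))

  count-single : {P : Pred A ℓ} (P? : Decidable P) {x₀ : A} → P x₀ → (∀ x → P x → x ≡ x₀) →
                 ∀ {xs} → Unique xs → x₀ ∈ xs → count P? xs ≡ 1
  count-single P? px₀ P! {x ∷ xs} (x∉xs ∷ xs!) x₀∈ with P? x | x₀∈
  ... | no ¬p | here refl = contradiction px₀ ¬p
  ... | no ¬p | there x₀∈xs = count-single P? px₀ P! xs! x₀∈xs
  ... | yes p | _ = cong suc (none xs x∉xs)
    where
    none : ∀ ys → All (x ≢_) ys → count P? ys ≡ 0
    none [] [] = refl
    none (y ∷ ys) (x≢y ∷ x∉ys) with P? y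
    ... | yes q = contradiction (trans (P! x p) (sym (P! y q))) x≢y
    ... | no  _ = none ys x∉ys

-- With `_∷_` for `f` this splits a sum over vectors by their first coordinate.
sum-cartesianProductWith : ∀ {c} {C : Set c} (f : A → B → C) (g : C → ℕ) → ∀ xs ys →
  sum (map g (cartesianProductWith f xs ys)) ≡ sum (map (λ x → sum (map (g ∘ f x) ys)) xs)
sum-cartesianProductWith f g [] ys = refl
sum-cartesianProductWith f g (x ∷ xs) ys = begin
  sum (map g (map (f x) ys ++ rest))            ≡⟨ cong sum (map-++ g (map (f x) ys) rest) ⟩
  sum (map g (map (f x) ys) ++ map g rest)      ≡⟨ sum-++ (map g (map (f x) ys)) _ ⟩
  sum (map g (map (f x) ys)) + sum (map g rest)
    ≡⟨ cong₂ _+_ (cong sum (sym (map-∘ ys))) (sum-cartesianProductWith f g xs ys) ⟩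
  sum (map (g ∘ f x) ys) + _                    ∎
  where
  open ≡-Reasoning
  rest = cartesianProductWith f xs ys

allVec : List A → ∀ n → List (Vec A n)
allVec xs zero    = [] ∷ []
allVec xs (suc n) = cartesianProductWith _∷_ xs (allVec xs n)

allVec-unique : {xs : List A} → Unique xs → ∀ n → Unique (allVec xs n)
allVec-unique xs! zero    = [] ∷ []
allVec-unique xs! (suc n) =
  Unique.cartesianProductWith⁺ _∷_ Vec.∷-injective xs! (allVec-unique xs! n)

allVec-complete : {xs : List A} → (∀ x → x ∈ xs) → ∀ {n} (v : Vec A n) → v ∈ allVec xs n
allVec-complete ∈xs []      = here refl
allVec-complete ∈xs (x ∷ v) = ∈-cartesianProductWith⁺ _∷_ (∈xs x) (allVec-complete ∈xs v)

-- Recognising a filtration as a family of iterated sumsets.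

module _ {c ℓ} (G : AbelianGroup c ℓ) where

  open AbelianGroup G using (Carrier; _≈_; _∙_; ε; ∙-congˡ) renaming (refl to ≈-refl; trans to ≈-trans)

  module _ {r} (R : ℕ → Pred Carrier r)
           (R-resp : ∀ {h x y} → x ≈ y → R h y → R h x)
           (R-ε : R 0 ε) (R-ε! : ∀ {x} → R 0 x → x ≈ ε)
           (R-∙ : ∀ {h x y} → R 1 x → R h y → R (suc h) (x ∙ y))
           (R-split : ∀ {h x} → R (suc h) x → ∃[ y ] ∃[ z ] R 1 y × R h z × x ≈ y ∙ z)
    where

    -- Both directions go by induction on `h`: `R-∙` absorbs the first summand, and `R-split`
    -- produces one.
    sumset-filtration : ∀ h x → Sumset G h (R 1) x ⇔ R h x
    sumset-filtration h x = mk⇔ (to h) (from h)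
      where
      to : ∀ h {x} → Sumset G h (R 1) x → R h x
      to zero    (s , s∈ , eq) = R-resp eq R-ε
      to (suc h) (s , s∈ , eq) =
        R-resp eq (R-∙ (s∈ zero) (to h (s ∘ suc , s∈ ∘ suc , ≈-refl)))

      from : ∀ h {x} → R h x → Sumset G h (R 1) x
      from zero    x∈ = (λ ()) , (λ ()) , R-ε! x∈
      from (suc h) x∈ with y , z , y∈ , z∈ , eq ← R-split x∈ with s , s∈ , z≈ ← from h z∈ =
        (y Vector.∷ s) , (λ { zero → y∈ ; (suc i) → s∈ i }) , ≈-trans eq (∙-congˡ z≈)

-- Unitriangular systems over the integers.

-- Meant for two sets cut from the same set of size `c`: comparing what remains reverses the
-- comparison of what was removed.
⊖-of-complements : ∀ {c} k a l b → c ≡ k + a → c ≡ l + b → + k - + l ≡ + b - + a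
⊖-of-complements k a l b c≡k+a c≡l+b = begin
  + k - + l            ≡⟨ ℤ.m-n≡m⊖n k l ⟩
  k ℤ.⊖ l              ≡⟨ ℤ.+-cancelˡ-⊖ a k l ⟨
  (a + k) ℤ.⊖ (a + l)  ≡⟨ cong₂ ℤ._⊖_ (trans (ℕ.+-comm a k) (trans (sym c≡k+a) c≡l+b)) (ℕ.+-comm a l) ⟩
  (l + b) ℤ.⊖ (l + a)  ≡⟨ ℤ.+-cancelˡ-⊖ l b a ⟩
  b ℤ.⊖ a              ≡⟨ ℤ.m-n≡m⊖n b a ⟨
  + b - + a            ∎
  where open ≡-Reasoning

-- The list encodes a nonnegative coefficient vector by multiplicity: the coefficient of `κ j` is
-- the number of occurrences of `j`.
combination : (ℕ → ℕ → ℕ) → List ℕ → ℕ → ℕ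
combination κ js i = sum (map (λ j → κ j i) js)

combination-replicate : ∀ κ k j js i → combination κ (replicate k j ++ js) i ≡ k * κ j i + combination κ js i
combination-replicate κ zero    j js i = refl
combination-replicate κ (suc k) j js i =
  trans (cong (λ s → κ j i + s) (combination-replicate κ k j js i)) (sym (ℕ.+-assoc (κ j i) _ _))

combination-small : ∀ {κ i js} → (∀ {i j} → j < i → κ j i ≡ 0) → All (_< i) js → combination κ js i ≡ 0
combination-small κ≡0 []           = refl
combination-small κ≡0 (j<i ∷ js<i) = cong₂ _+_ (κ≡0 j<i) (combination-small κ≡0 js<i)

as-difference : ∀ z → ∃[ a ] ∃[ b ] + a - + b ≡ z
as-difference (+ a)    = a , 0 , ℤ.+-identityʳ (+ a)
as-difference -[1+ b ] = 0 , suc b , refl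

regroup : ∀ a b k J K → + (a * k + J) - + (b * k + K) ≡ (+ a - + b) ℤ.* + k ℤ.+ (+ J - + K)
regroup a b k J K = trans
  (cong₂ _-_ (trans (ℤ.pos-+ (a * k) J) (cong (λ x → x ℤ.+ + J) (ℤ.pos-* a k)))
             (trans (ℤ.pos-+ (b * k) K) (cong (λ x → x ℤ.+ + K) (ℤ.pos-* b k))))
  (solve 5 (λ a b k J K → (a :* k :+ J) :- (b :* k :+ K) := (a :- b) :* k :+ (J :- K)) refl
    (+ a) (+ b) (+ k) (+ J) (+ K))
  where open +-*-Solver

-- Back substitution: equation `H` fixes the coefficient `a - b` of unknown `H`, since the unknowns
-- below `H` do not enter it. The bounds on the entries of both lists record this for the induction.
unitriangular-solvable : (κ : ℕ → ℕ → ℕ) → (∀ {i j} → j < i → κ j i ≡ 0) →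
  ∀ H → (∀ {j} → j < H → κ j j ≡ 1) → (m : ℕ → ℤ) →
  ∃[ js ] ∃[ ks ] All (_< H) js × All (_< H) ks ×
    (∀ i → i < H → + combination κ js i - + combination κ ks i ≡ m i)
unitriangular-solvable κ κ≡0 zero    κ≡1 m = [] , [] , [] , [] , λ _ ()
unitriangular-solvable κ κ≡0 (suc H) κ≡1 m
  with a , b , a-b≡ ← as-difference (m H)
  with js , ks , js< , ks< , solved ←
    -- The earlier targets are corrected in advance for what unknown `H` contributes to them.
    unitriangular-solvable κ κ≡0 H (κ≡1 ∘ ℕ.m<n⇒m<1+n) (λ i → m i - (+ a - + b) ℤ.* + κ H i) =
  replicate a H ++ js , replicate b H ++ ks , extend a js< , extend b ks< , solution
  where
  extend : ∀ c {xs} → All (_< H) xs → All (_< suc H) (replicate c H ++ xs)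
  extend c xs< = All.++⁺ (All.replicate⁺ c (ℕ.n<1+n H)) (All.map ℕ.m<n⇒m<1+n xs<)

  expand : ∀ i → + combination κ (replicate a H ++ js) i - + combination κ (replicate b H ++ ks) i ≡
                 (+ a - + b) ℤ.* + κ H i ℤ.+ (+ combination κ js i - + combination κ ks i)
  expand i = trans
    (cong₂ (λ s t → + s - + t) (combination-replicate κ a H js i) (combination-replicate κ b H ks i))
    (regroup a b (κ H i) (combination κ js i) (combination κ ks i))

  cancel : ∀ x y → x ℤ.+ (y - x) ≡ y
  cancel = solve 2 (λ x y → x :+ (y :- x) := y) refl
    where open +-*-Solver

  solution : ∀ i → i < suc H →
             + combination κ (replicate a H ++ js) i - + combination κ (replicate b H ++ ks) i ≡ m i
  solution i i<1+H with ℕ.m<1+n⇒m<n∨m≡n i<1+H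
  ... | inj₁ i<H  = begin
    _                                             ≡⟨ expand i ⟩
    (+ a - + b) ℤ.* + κ H i ℤ.+ _                 ≡⟨ cong (λ s → (+ a - + b) ℤ.* + κ H i ℤ.+ s) (solved i i<H) ⟩
    (+ a - + b) ℤ.* + κ H i ℤ.+ (m i - (+ a - + b) ℤ.* + κ H i)
                                                  ≡⟨ cancel ((+ a - + b) ℤ.* + κ H i) (m i) ⟩
    m i                                           ∎
    where open ≡-Reasoning
  ... | inj₂ refl = begin
    _                                      ≡⟨ expand H ⟩
    (+ a - + b) ℤ.* + κ H H ℤ.+ (+ combination κ js H - + combination κ ks H)
      ≡⟨ cong₂ (λ s t → (+ a - + b) ℤ.* + κ H H ℤ.+ (+ s - + t))
            (combination-small κ≡0 js<) (combination-small κ≡0 ks<) ⟩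
    (+ a - + b) ℤ.* + κ H H ℤ.+ + 0        ≡⟨ ℤ.+-identityʳ _ ⟩
    (+ a - + b) ℤ.* + κ H H                ≡⟨ cong (λ k → (+ a - + b) ℤ.* + k) (κ≡1 (ℕ.n<1+n H)) ⟩
    (+ a - + b) ℤ.* + 1                    ≡⟨ ℤ.*-identityʳ _ ⟩
    + a - + b                              ≡⟨ a-b≡ ⟩
    m H                                    ∎
    where open ≡-Reasoning

-- Blocks, spread vectors and holes.

module Construction (q : ℕ) where

  p : ℕ
  p = suc (suc q)

  open ℤmod p

  F : Set
  F = Fin p

  L : Set
  L = F × F

  Block : Set
  Block = L × F

  Blocks : ℕ → Set
  Blocks = Vec Block

  private
    variable
      k n r : ℕ

  0ᴸ : L
  0ᴸ = zero , zero

  infixl 6 _⊕ᴸ_ _⊕ᴮ_ _⊞_ _⊞ᴮ_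

  _⊕ᴸ_ : L → L → L
  (a , b) ⊕ᴸ (c , d) = a ⊕ c , b ⊕ d

  _⊕ᴮ_ : Block → Block → Block
  (ℓ , c) ⊕ᴮ (m , d) = ℓ ⊕ᴸ m , c ⊕ d

  _⊞_ : Vec F n → Vec F n → Vec F n
  _⊞_ = zipWith _⊕_

  _⊞ᴮ_ : Blocks n → Blocks n → Blocks n
  _⊞ᴮ_ = zipWith _⊕ᴮ_

  0ⱽ : Vec F n
  0ⱽ = Vec.replicate _ zero

  0ᴮ : Blocks n
  0ᴮ = Vec.replicate _ (0ᴸ , zero)

  0ᴸ? : ∀ ℓ → Dec (ℓ ≡ 0ᴸ)
  0ᴸ? (zero  , zero)  = yes refl
  0ᴸ? (zero  , suc _) = no λ ()
  0ᴸ? (suc _ , _)     = no λ ()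

  ⊕ᴸ-identityˡ : ∀ ℓ → 0ᴸ ⊕ᴸ ℓ ≡ ℓ
  ⊕ᴸ-identityˡ (a , b) = cong₂ _,_ (⊕-identityˡ a) (⊕-identityˡ b)

  ⊕ᴸ-identityʳ : ∀ ℓ → ℓ ⊕ᴸ 0ᴸ ≡ ℓ
  ⊕ᴸ-identityʳ (a , b) = cong₂ _,_ (⊕-identityʳ a) (⊕-identityʳ b)

  ⊕ᴮ-comm : ∀ x y → x ⊕ᴮ y ≡ y ⊕ᴮ x
  ⊕ᴮ-comm ((a , b) , c) ((a′ , b′) , c′) =
    cong₂ _,_ (cong₂ _,_ (⊕-comm a a′) (⊕-comm b b′)) (⊕-comm c c′)

  ⊞-identityˡ : (v : Vec F n) → 0ⱽ ⊞ v ≡ v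
  ⊞-identityˡ = Vec.zipWith-identityˡ ⊕-identityˡ

  ⊞-identityʳ : (v : Vec F n) → v ⊞ 0ⱽ ≡ v
  ⊞-identityʳ = Vec.zipWith-identityʳ ⊕-identityʳ

  ⊞ᴮ-identityˡ : (v : Blocks n) → 0ᴮ ⊞ᴮ v ≡ v
  ⊞ᴮ-identityˡ = Vec.zipWith-identityˡ (λ (ℓ , c) → cong₂ _,_ (⊕ᴸ-identityˡ ℓ) (⊕-identityˡ c))

  ⊞ᴮ-comm : (u v : Blocks n) → u ⊞ᴮ v ≡ v ⊞ᴮ u
  ⊞ᴮ-comm = Vec.zipWith-comm ⊕ᴮ-comm

  minus-plus : ∀ x y → x ≡ (x ⊕ ⊖ y) ⊕ y
  minus-plus x y = sym (begin
    (x ⊕ ⊖ y) ⊕ y    ≡⟨ ⊕-assoc x (⊖ y) y ⟩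
    x ⊕ ((⊖ y) ⊕ y)  ≡⟨ cong (x ⊕_) (⊖-inverseˡ y) ⟩
    x ⊕ 𝟘            ≡⟨ ⊕-identityʳ x ⟩
    x                ∎)
    where open ≡-Reasoning

  -- This fails for L = ℤ/2ℤ, hence the choice L = F².
  sum-of-nonzero : ∀ ℓ → ∃[ m ] ∃[ k ] ℓ ≡ m ⊕ᴸ k × m ≢ 0ᴸ × k ≢ 0ᴸ
  sum-of-nonzero (a , b) with a Fin.≟ suc zero
  ... | yes refl = (suc zero , b ⊕ ⊖ suc zero) , (zero , suc zero) ,
        cong₂ _,_ (sym (⊕-identityʳ (suc zero))) (minus-plus b (suc zero)) , (λ ()) , (λ ())
  ... | no a≢1 = (a ⊕ ⊖ suc zero , b) , (suc zero , zero) ,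
        cong₂ _,_ (minus-plus a (suc zero)) (sym (⊕-identityʳ b)) ,
        (λ eq → a≢1 (trans (minus-plus a (suc zero))
                           (trans (cong (λ x → proj₁ x ⊕ suc zero) eq) (⊕-identityˡ (suc zero))))) ,
        (λ ())

  supp : F → ℕ
  supp zero    = 0
  supp (suc _) = 1

  weight : ∀ n → Blocks n → ℕ
  weight zero    []            = 0
  weight (suc n) ((_ , c) ∷ v) = supp c + weight n v

  -- A zero marker forces `ℓ = 0`, so the only spread vector of weight 0 is zero. Over the marker 1
  -- just `ℓ = 0` is excluded, and this makes the point of top weight in a hole unique.
  SpreadBlock : L → F → Set
  SpreadBlock ℓ zero          = ℓ ≡ 0ᴸ
  SpreadBlock ℓ (suc zero)    = ℓ ≢ 0ᴸ
  SpreadBlock ℓ (suc (suc _)) = ⊤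

  Spread : ∀ n → Blocks n → Set
  Spread zero    []            = ⊤
  Spread (suc n) ((ℓ , c) ∷ v) = SpreadBlock ℓ c × Spread n v

  -- Let box τ ⊆ L be L ∖ {0} or {0} according as τ is true or false.  The block (ℓ , c) lies in the hole if
  -- every m with SpreadBlock m c has ℓ - m ∈ box τ.
  HoleBlock : Bool → L → F → Set
  HoleBlock true  ℓ zero          = ℓ ≢ 0ᴸ
  HoleBlock true  ℓ (suc zero)    = ℓ ≡ 0ᴸ
  HoleBlock true  ℓ (suc (suc _)) = ⊥
  HoleBlock false ℓ zero          = ℓ ≡ 0ᴸ
  HoleBlock false ℓ (suc _)       = ⊥

  Hole : Vec Bool n → Blocks n → Set
  Hole []       []            = ⊤
  Hole (τ ∷ τs) ((ℓ , c) ∷ v) = HoleBlock τ ℓ c × Hole τs v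

  spreadBlock? : ∀ ℓ c → Dec (SpreadBlock ℓ c)
  spreadBlock? ℓ zero          = 0ᴸ? ℓ
  spreadBlock? ℓ (suc zero)    = ¬? (0ᴸ? ℓ)
  spreadBlock? ℓ (suc (suc _)) = yes tt

  spread? : ∀ n v → Dec (Spread n v)
  spread? zero    []            = yes tt
  spread? (suc n) ((ℓ , c) ∷ v) = spreadBlock? ℓ c ×-dec spread? n v

  holeBlock? : ∀ τ ℓ c → Dec (HoleBlock τ ℓ c)
  holeBlock? true  ℓ zero          = ¬? (0ᴸ? ℓ)
  holeBlock? true  ℓ (suc zero)    = 0ᴸ? ℓ
  holeBlock? true  ℓ (suc (suc _)) = no id
  holeBlock? false ℓ zero          = 0ᴸ? ℓ
  holeBlock? false ℓ (suc _)       = no id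

  hole? : (τs : Vec Bool n) → ∀ v → Dec (Hole τs v)
  hole? []       []            = yes tt
  hole? (τ ∷ τs) ((ℓ , c) ∷ v) = holeBlock? τ ℓ c ×-dec hole? τs v

  weight-zeros : ∀ n → weight n 0ᴮ ≡ 0
  weight-zeros zero    = refl
  weight-zeros (suc n) = weight-zeros n

  spread-zeros : ∀ n → Spread n 0ᴮ
  spread-zeros zero    = tt
  spread-zeros (suc n) = refl , spread-zeros n

  spread-weight-zero : ∀ n v → weight n v ≡ 0 → Spread n v → v ≡ 0ᴮ
  spread-weight-zero zero    []               _   _          = refl
  spread-weight-zero (suc n) ((_ , zero) ∷ v) w≡0 (refl , s) =
    cong ((0ᴸ , zero) ∷_) (spread-weight-zero n v w≡0 s)

  -- Weights of sums and disjoint supports.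

  Disjoint : F → F → Set
  Disjoint c d = c ≡ zero ⊎ d ≡ zero

  DisjointBlocks : ∀ n → Blocks n → Blocks n → Set
  DisjointBlocks zero    _             _             = ⊤
  DisjointBlocks (suc n) ((_ , c) ∷ u) ((_ , d) ∷ v) = Disjoint c d × DisjointBlocks n u v

  disjoint-sym : ∀ {c d} → Disjoint c d → Disjoint d c
  disjoint-sym (inj₁ c≡0) = inj₂ c≡0
  disjoint-sym (inj₂ d≡0) = inj₁ d≡0

  disjointBlocks-sym : ∀ n u v → DisjointBlocks n u v → DisjointBlocks n v u
  disjointBlocks-sym zero    _             _             _         = tt
  disjointBlocks-sym (suc n) ((_ , c) ∷ u) ((_ , d) ∷ v) (dis , ds) =
    disjoint-sym dis , disjointBlocks-sym n u v ds

  -- Subadditivity in which equality comes with a certificate `D`, so that disjointness can be read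
  -- off from an equality of weights.
  Additive : Set → ℕ → ℕ → ℕ → Set
  Additive D s i j = (D × s ≡ i + j) ⊎ s < i + j

  -- A strict loss in either coordinate is a strict loss in total, so equality of the totals
  -- certifies both coordinates.
  additive-+ : ∀ {D E} s t i j k l → Additive D s i j → Additive E t k l →
               Additive (D × E) (s + t) (i + k) (j + l)
  additive-+ s t i j k l
    with eq ← interchange ℕ.+-commutativeSemigroup i j k l = λ where
      (inj₁ (d , s≡)) (inj₁ (e , t≡)) → inj₁ ((d , e) , trans (cong₂ _+_ s≡ t≡) eq)
      (inj₁ (d , s≡)) (inj₂ t<)       → inj₂ (subst (s + t <_) eq (ℕ.+-mono-≤-< (ℕ.≤-reflexive s≡) t<))
      (inj₂ s<)       (inj₁ (e , t≡)) → inj₂ (subst (s + t <_) eq (ℕ.+-mono-<-≤ s< (ℕ.≤-reflexive t≡)))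
      (inj₂ s<)       (inj₂ t<)       → inj₂ (subst (s + t <_) eq (ℕ.+-mono-< s< t<))

  supp≤1 : ∀ c → supp c ≤ 1
  supp≤1 zero    = z≤n
  supp≤1 (suc _) = s≤s z≤n

  supp-⊕ : ∀ c d → Additive (Disjoint c d) (supp (c ⊕ d)) (supp c) (supp d)
  supp-⊕ zero    d       = inj₁ (inj₁ refl , cong supp (⊕-identityˡ d))
  supp-⊕ (suc c) zero    = inj₁ (inj₂ refl , cong supp (⊕-identityʳ (suc c)))
  supp-⊕ (suc c) (suc d) = inj₂ (s≤s (supp≤1 (suc c ⊕ suc d)))

  weight-⊞ : ∀ n u v → Additive (DisjointBlocks n u v) (weight n (u ⊞ᴮ v)) (weight n u) (weight n v)
  weight-⊞ zero    []            []            = inj₁ (tt , refl)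
  weight-⊞ (suc n) ((_ , c) ∷ u) ((_ , d) ∷ v) =
    additive-+ _ _ (supp c) (supp d) _ _ (supp-⊕ c d) (weight-⊞ n u v)

  spreadBlock-⊕ : ∀ ℓ m c d → Disjoint c d → SpreadBlock ℓ c → SpreadBlock m d → SpreadBlock (ℓ ⊕ᴸ m) (c ⊕ d)
  spreadBlock-⊕ _ m zero d (inj₁ refl) refl fm =
    subst₂ SpreadBlock (sym (⊕ᴸ-identityˡ m)) (sym (⊕-identityˡ d)) fm
  spreadBlock-⊕ ℓ _ c zero (inj₂ refl) fℓ refl =
    subst₂ SpreadBlock (sym (⊕ᴸ-identityʳ ℓ)) (sym (⊕-identityʳ c)) fℓ

  spread-⊞ : ∀ n u v → DisjointBlocks n u v → Spread n u → Spread n v → Spread n (u ⊞ᴮ v)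
  spread-⊞ zero    []            []            _          _        _        = tt
  spread-⊞ (suc n) ((_ , c) ∷ u) ((_ , d) ∷ v) (dis , ds) (f , fs) (g , gs) =
    spreadBlock-⊕ _ _ c d dis f g , spread-⊞ n u v ds fs gs

  -- If `c = 0`, then `ℓ = 0` and nothing changes. If `d = 0`, then `ℓ` is one of the elements
  -- tested by the hole at marker `c`, so removing it from `ℓ ⊕ᴸ m` leaves `m` in the box.
  holeBlock-⊕ : ∀ τ ℓ m c d → Disjoint c d → SpreadBlock ℓ c → HoleBlock τ (ℓ ⊕ᴸ m) (c ⊕ d) → HoleBlock τ m d
  holeBlock-⊕ τ _ m zero d (inj₁ refl) refl hole =
    subst₂ (HoleBlock τ) (⊕ᴸ-identityˡ m) (⊕-identityˡ d) hole
  holeBlock-⊕ τ ℓ m c zero (inj₂ refl) free hole =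
    go τ c free (subst (HoleBlock τ (ℓ ⊕ᴸ m)) (⊕-identityʳ c) hole)
    where
    go : ∀ τ c → SpreadBlock ℓ c → HoleBlock τ (ℓ ⊕ᴸ m) c → HoleBlock τ m zero
    go true  zero       refl hole = subst (_≢ 0ᴸ) (⊕ᴸ-identityˡ m) hole
    go true  (suc zero) ℓ≢0  ℓ+m≡0 refl = ℓ≢0 (trans (sym (⊕ᴸ-identityʳ ℓ)) ℓ+m≡0)
    go false zero       refl hole = trans (sym (⊕ᴸ-identityˡ m)) hole

  -- Used contrapositively: adding a spread vector of disjoint support cannot move a point into the
  -- hole.
  hole-⊞ : (τs : Vec Bool n) → ∀ u v → DisjointBlocks n u v → Spread n u → Hole τs (u ⊞ᴮ v) → Hole τs v
  hole-⊞ []       []            []            _          _        _        = tt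
  hole-⊞ (τ ∷ τs) ((_ , c) ∷ u) ((_ , d) ∷ v) (dis , ds) (f , fs) (h , hs) =
    holeBlock-⊕ τ _ _ c d dis f h , hole-⊞ τs u v ds fs hs

  -- Splitting vectors of blocks.

  -- The marker goes with `m`. If `ℓ` is admissible, `m` takes all of it; otherwise the marker is 1
  -- and `ℓ = 0`, a sum of two nonzero elements.
  peelBlock : ∀ ℓ c → ∃[ m ] ∃[ k ] ℓ ≡ m ⊕ᴸ k × SpreadBlock m (suc c) × (SpreadBlock ℓ (suc c) → k ≡ 0ᴸ)
  peelBlock ℓ (suc c) = ℓ , 0ᴸ , sym (⊕ᴸ-identityʳ ℓ) , tt , λ _ → refl
  peelBlock ℓ zero with 0ᴸ? ℓ
  ... | no  ℓ≢0 = ℓ , 0ᴸ , sym (⊕ᴸ-identityʳ ℓ) , ℓ≢0 , λ _ → refl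
  ... | yes ℓ≡0 with m , k , eq , m≢0 , _ ← sum-of-nonzero ℓ =
    m , k , eq , m≢0 , λ ℓ≢0 → contradiction ℓ≡0 ℓ≢0

  peel : ∀ n v → weight n v ≡ suc k →
         ∃[ u ] ∃[ w ] v ≡ u ⊞ᴮ w × weight n u ≡ 1 × Spread n u × weight n w ≡ k × (Spread n v → Spread n w)
  peel (suc n) ((ℓ , zero) ∷ v) eq
    with u , w , v≡ , u1 , us , wk , ws ← peel n v eq =
    ((0ᴸ , zero) ∷ u) , ((ℓ , zero) ∷ w) ,
    cong₂ (λ m → (m , zero) ∷_) (sym (⊕ᴸ-identityˡ ℓ)) v≡ ,
    u1 , (refl , us) , wk , λ { (ℓ≡0 , s) → ℓ≡0 , ws s }
  peel (suc n) ((ℓ , suc c) ∷ v) eq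
    with m , k , ℓ≡ , f , k≡ ← peelBlock ℓ c =
    ((m , suc c) ∷ 0ᴮ) , ((k , zero) ∷ v) ,
    cong₂ _∷_ (cong₂ _,_ ℓ≡ (sym (⊕-identityʳ (suc c)))) (sym (⊞ᴮ-identityˡ v)) ,
    cong suc (weight-zeros n) , (f , spread-zeros n) , ℕ.suc-injective eq , λ { (g , s) → k≡ g , s }

  -- Here the marker goes with the admissible `k`, and `m` will sit over a zero marker, where weight
  -- 0 allows any value.
  cleaveBlock : ∀ ℓ c → ∃[ m ] ∃[ k ] ℓ ≡ m ⊕ᴸ k × SpreadBlock k c
  cleaveBlock ℓ zero          = ℓ , 0ᴸ , sym (⊕ᴸ-identityʳ ℓ) , refl
  cleaveBlock ℓ (suc zero)    with m , k , eq , _ , k≢0 ← sum-of-nonzero ℓ = m , k , eq , k≢0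
  cleaveBlock ℓ (suc (suc _)) = ℓ , 0ᴸ , sym (⊕ᴸ-identityʳ ℓ) , tt

  -- Outside the hole some admissible `k` leaves `m` outside the box. For `true` this means `m = 0`
  -- and `k = ℓ`; for `false` any nonzero `m` will do.
  cleaveBlock-avoiding : ∀ τ ℓ c → ¬ HoleBlock τ ℓ c →
                         ∃[ m ] ∃[ k ] ℓ ≡ m ⊕ᴸ k × SpreadBlock k c × ¬ HoleBlock τ m zero
  cleaveBlock-avoiding τ     ℓ zero          ¬hole = ℓ , 0ᴸ , sym (⊕ᴸ-identityʳ ℓ) , refl , ¬hole
  cleaveBlock-avoiding true  ℓ (suc zero)    ℓ≢0   = 0ᴸ , ℓ , sym (⊕ᴸ-identityˡ ℓ) , ℓ≢0 , λ 0≢0 → 0≢0 refl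
  cleaveBlock-avoiding true  ℓ (suc (suc _)) _     = 0ᴸ , ℓ , sym (⊕ᴸ-identityˡ ℓ) , tt , λ 0≢0 → 0≢0 refl
  cleaveBlock-avoiding false ℓ (suc zero)    _
    with m , k , eq , m≢0 , k≢0 ← sum-of-nonzero ℓ = m , k , eq , k≢0 , m≢0
  cleaveBlock-avoiding false ℓ (suc (suc _)) _
    with m , k , eq , m≢0 , _ ← sum-of-nonzero ℓ = m , k , eq , tt , m≢0

  Cleaving : ∀ n → Blocks n → Blocks n → Blocks n → Set
  Cleaving n v u w = v ≡ u ⊞ᴮ w × weight n u ≡ 0 × Spread n w × weight n w ≡ weight n v

  cleaving-∷ : ∀ {n ℓ k c} {v u w : Blocks n} m → ℓ ≡ m ⊕ᴸ k → SpreadBlock k c → Cleaving n v u w →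
               Cleaving (suc n) ((ℓ , c) ∷ v) ((m , zero) ∷ u) ((k , c) ∷ w)
  cleaving-∷ {c = c} m ℓ≡ f (v≡ , u0 , s , eq) =
    cong₂ _∷_ (cong₂ _,_ ℓ≡ (sym (⊕-identityˡ c))) v≡ , u0 , (f , s) , cong (λ j → supp c + j) eq

  cleave : ∀ n v → ∃[ u ] ∃[ w ] Cleaving n v u w
  cleave zero    []            = [] , [] , refl , refl , tt , refl
  cleave (suc n) ((ℓ , c) ∷ v)
    with m , k , ℓ≡ , f ← cleaveBlock ℓ c | u , w , cl ← cleave n v =
    ((m , zero) ∷ u) , ((k , c) ∷ w) , cleaving-∷ m ℓ≡ f cl

  -- A hole is a product over the blocks, so `v` misses some factor; it suffices to avoid the box at
  -- that block and split the others arbitrarily.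
  cleave-avoiding : (τs : Vec Bool n) → ∀ v → ¬ Hole τs v →
                    ∃[ u ] ∃[ w ] Cleaving n v u w × ¬ Hole τs u
  cleave-avoiding []       []            ¬hole = contradiction tt ¬hole
  cleave-avoiding {suc n} (τ ∷ τs) ((ℓ , c) ∷ v) ¬hole with holeBlock? τ ℓ c
  ... | yes hole
    with m , k , ℓ≡ , f ← cleaveBlock ℓ c
       | u , w , cl , ¬hole-u ← cleave-avoiding τs v (λ holes → ¬hole (hole , holes)) =
    ((m , zero) ∷ u) , ((k , c) ∷ w) , cleaving-∷ m ℓ≡ f cl , ¬hole-u ∘ proj₂
  ... | no ¬h
    with m , k , ℓ≡ , f , ¬hm ← cleaveBlock-avoiding τ ℓ c ¬h | u , w , cl ← cleave n v =
    ((m , zero) ∷ u) , ((k , c) ∷ w) , cleaving-∷ m ℓ≡ f cl , ¬hm ∘ proj₁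

  -- The filtration of the points by weight and edges.

  Point : ℕ → ℕ → Set
  Point n r = Vec F r × (F × Blocks n)

  _⊞ᴾ_ : Point n r → Point n r → Point n r
  (t , e , u) ⊞ᴾ (t′ , f , v) = t ⊞ t′ , e ⊕ f , u ⊞ᴮ v

  total : Point n r → ℕ
  total {n} (_ , e , v) = supp e + weight n v

  HoleOf : Maybe (Vec Bool n) → Blocks n → Set
  HoleOf nothing   v = ⊥
  HoleOf (just τs) v = Hole τs v

  holeOf? : (τ : Maybe (Vec Bool n)) → ∀ v → Dec (HoleOf τ v)
  holeOf? nothing   v = no id
  holeOf? (just τs) v = hole? τs v

  holeOf-⊞ : (τ : Maybe (Vec Bool n)) → ∀ u v → DisjointBlocks n u v → Spread n u →
             HoleOf τ (u ⊞ᴮ v) → HoleOf τ v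
  holeOf-⊞ (just τs) = hole-⊞ τs

  cleaveOf : (τ : Maybe (Vec Bool n)) → ∀ v → ¬ HoleOf τ v → ∃[ u ] ∃[ w ] Cleaving n v u w × ¬ HoleOf τ u
  cleaveOf nothing   v _ with u , w , cl ← cleave _ v = u , w , cl , id
  cleaveOf (just τs) v   = cleave-avoiding τs v

  module Filtration {n r} (ψ : Vec F r → Maybe (Vec Bool n)) (ψ-0 : ψ 0ⱽ ≡ nothing) where

    origin : Point n r
    origin = 0ⱽ , zero , 0ᴮ

    -- Requiring `t ≡ 0ⱽ` when `e = 0` ensures that adding such an edge does not change which hole
    -- applies.
    Edge : Point n r → Set
    Edge (t , zero        , v) = t ≡ 0ⱽ × Spread n v
    Edge (t , suc zero    , v) = ¬ HoleOf (ψ t) v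
    Edge (t , suc (suc _) , v) = ⊤

    R : ℕ → Point n r → Set
    R h x = total x < h ⊎ (total x ≡ h × Edge x)

    edge? : ∀ x → Dec (Edge x)
    edge? (t , zero        , v) = Vec.≡-dec Fin._≟_ t 0ⱽ ×-dec spread? n v
    edge? (t , suc zero    , v) = ¬? (holeOf? (ψ t) v)
    edge? (t , suc (suc _) , v) = yes tt

    R? : ∀ h x → Dec (R h x)
    R? h x = (total x ℕ.<? h) ⊎-dec ((total x ℕ.≟ h) ×-dec edge? x)

    total-origin : total origin ≡ 0
    total-origin = weight-zeros n

    R-origin : ∀ h → R h origin
    R-origin zero    = inj₂ (total-origin , refl , spread-zeros n)
    R-origin (suc h) = inj₁ (subst (_< suc h) (sym total-origin) (s≤s z≤n))

    R-zero : ∀ x → R 0 x → x ≡ origin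
    R-zero (t , zero , v) (inj₂ (w≡0 , refl , s)) =
      cong (λ u → 0ⱽ , zero , u) (spread-weight-zero n v w≡0 s)

    edge-⊞ˡ : ∀ t f u v → DisjointBlocks n u v → Spread n u → Edge (t , f , v) → Edge (t , f , u ⊞ᴮ v)
    edge-⊞ˡ t zero          u v dis s (t≡0 , s′) = t≡0 , spread-⊞ n u v dis s s′
    edge-⊞ˡ t (suc zero)    u v dis s ¬hole      = ¬hole ∘ holeOf-⊞ (ψ t) u v dis s
    edge-⊞ˡ t (suc (suc _)) u v dis s _          = tt

    -- Disjointness makes one of `e`, `f` zero; that edge has tail 0 and is spread, so it preserves
    -- the other one.
    edge-⊞ᴾ : ∀ t t′ e f u v → Disjoint e f × DisjointBlocks n u v →
              Edge (t , e , u) → Edge (t′ , f , v) → Edge (t ⊞ t′ , e ⊕ f , u ⊞ᴮ v)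
    edge-⊞ᴾ _ t′ _ f u v (inj₁ refl , dis) (refl , s) y =
      subst₂ (λ t e → Edge (t , e , u ⊞ᴮ v)) (sym (⊞-identityˡ t′)) (sym (⊕-identityˡ f))
        (edge-⊞ˡ t′ f u v dis s y)
    edge-⊞ᴾ t _ e _ u v (inj₂ refl , dis) x (refl , s) =
      subst Edge (cong₂ _,_ (sym (⊞-identityʳ t)) (cong₂ _,_ (sym (⊕-identityʳ e)) (⊞ᴮ-comm v u)))
        (edge-⊞ˡ t e v u (disjointBlocks-sym n u v dis) s x)

    R-⊞ : ∀ h k x y → R h x → R k y → R (h + k) (x ⊞ᴾ y)
    R-⊞ h k x@(t , e , u) y@(t′ , f , v) Rx Ry
      with additive-+ _ _ (supp e) (supp f) _ _ (supp-⊕ e f) (weight-⊞ n u v) | Rx | Ry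
    -- A strict loss of weight puts the sum below level `h + k`, where every point is allowed.
    ... | inj₂ lt | _ | _ = inj₁ (ℕ.<-≤-trans lt (ℕ.+-mono-≤ (total≤ x h Rx) (total≤ y k Ry)))
      where
      total≤ : ∀ x h → R h x → total x ≤ h
      total≤ x h (inj₁ lt)       = ℕ.<⇒≤ lt
      total≤ x h (inj₂ (eq , _)) = ℕ.≤-reflexive eq
    ... | inj₁ (_ , eq) | inj₁ x< | inj₁ y< = inj₁ (subst (_< h + k) (sym eq) (ℕ.+-mono-< x< y<))
    ... | inj₁ (_ , eq) | inj₁ x< | inj₂ (y≡ , _) =
      inj₁ (subst (_< h + k) (sym eq) (ℕ.+-mono-<-≤ x< (ℕ.≤-reflexive y≡)))
    ... | inj₁ (_ , eq) | inj₂ (x≡ , _) | inj₁ y< =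
      inj₁ (subst (_< h + k) (sym eq) (ℕ.+-mono-≤-< (ℕ.≤-reflexive x≡) y<))
    ... | inj₁ (dis , eq) | inj₂ (x≡ , ex) | inj₂ (y≡ , ey) =
      inj₂ (trans eq (cong₂ _+_ x≡ y≡) , edge-⊞ᴾ t t′ e f u v dis ex ey)

    -- If `e = 0`, a block marker is split off; otherwise `y` takes `e`, and `z` keeps all the block
    -- markers.
    split-edge : ∀ x → total x ≡ suc k →
      ∃[ y ] ∃[ z ] x ≡ y ⊞ᴾ z × total y ≡ 1 × Edge y × total z ≡ k × (Edge x → Edge z)
    split-edge (t , zero , v) eq
      with u , w , v≡ , u1 , us , wk , ws ← peel n v eq =
      (0ⱽ , zero , u) , (t , zero , w) ,
      cong₂ _,_ (sym (⊞-identityˡ t)) (cong (zero ,_) v≡) ,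
      u1 , (refl , us) , wk , λ (t≡0 , s) → t≡0 , ws s
    split-edge (t , suc zero , v) eq with holeOf? (ψ t) v
    ... | yes hole =
      -- `x` is not an edge, so `z` need not be one. The marker `e` is split off at tail 0, where
      -- `ψ-0` leaves no hole.
      (0ⱽ , suc zero , 0ᴮ) , (t , zero , v) ,
      cong₂ _,_ (sym (⊞-identityˡ t)) (cong₂ _,_ (sym (⊕-identityʳ (suc zero))) (sym (⊞ᴮ-identityˡ v))) ,
      cong suc (weight-zeros n) , subst (λ τ → ¬ HoleOf τ 0ᴮ) (sym ψ-0) id ,
      ℕ.suc-injective eq , λ ¬hole → contradiction hole ¬hole
    ... | no ¬hole
      with u , w , (v≡ , u0 , s , w≡) , ¬hole-u ← cleaveOf (ψ t) v ¬hole =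
      -- The tail stays with `u`, which still avoids the hole at `t`; `w` is spread at tail 0.
      (t , suc zero , u) , (0ⱽ , zero , w) ,
      cong₂ _,_ (sym (⊞-identityʳ t)) (cong₂ _,_ (sym (⊕-identityʳ (suc zero))) v≡) ,
      cong suc u0 , ¬hole-u , trans w≡ (ℕ.suc-injective eq) , λ _ → refl , s
    split-edge (t , e@(suc (suc _)) , v) eq
      with u , w , v≡ , u0 , s , w≡ ← cleave n v =
      (t , e , u) , (0ⱽ , zero , w) ,
      cong₂ _,_ (sym (⊞-identityʳ t)) (cong₂ _,_ (sym (⊕-identityʳ e)) v≡) ,
      cong suc u0 , tt , trans w≡ (ℕ.suc-injective eq) , λ _ → refl , s

    R-split : ∀ h x → R (suc h) x → ∃[ y ] ∃[ z ] R 1 y × R h z × x ≡ y ⊞ᴾ z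
    R-split h x Rx = go (total x) refl
      where
      go : ∀ k → total x ≡ k → ∃[ y ] ∃[ z ] R 1 y × R h z × x ≡ y ⊞ᴾ z
      -- A point of weight 0 lies in `R 1` even when it is not an edge, and the origin lies in every
      -- level.
      go zero eq =
        x , origin , inj₁ (subst (_< 1) (sym eq) (s≤s z≤n)) , R-origin h , sym (⊞ᴾ-identityʳ x)
        where
        ⊞ᴾ-identityʳ : ∀ x → x ⊞ᴾ origin ≡ x
        ⊞ᴾ-identityʳ (t , e , v) =
          cong₂ _,_ (⊞-identityʳ t) (cong₂ _,_ (⊕-identityʳ e) (trans (⊞ᴮ-comm v 0ᴮ) (⊞ᴮ-identityˡ v)))
      go (suc k) eq with y , z , x≡ , y1 , ey , zk , ez ← split-edge x eq =
        y , z , inj₂ (y1 , ey) , Rz Rx , x≡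
        where
        Rz : R (suc h) x → R h z
        Rz (inj₁ x<)        = inj₁ (subst (_< h) (sym zk) (s<s⁻¹ (subst (_< suc h) eq x<)))
        Rz (inj₂ (x≡ , ex)) = inj₂ (trans zk (ℕ.suc-injective (trans (sym eq) x≡)) , ez ex)

  -- Coordinates identifying points with vectors over F.

  flatten : Blocks n → Vec F (n * 3)
  flatten []                  = []
  flatten (((a , b) , c) ∷ v) = a ∷ b ∷ c ∷ flatten v

  unflatten : ∀ n → Vec F (n * 3) → Blocks n
  unflatten zero    []                = []
  unflatten (suc n) (a ∷ b ∷ c ∷ v) = ((a , b) , c) ∷ unflatten n v

  flatten-unflatten : ∀ n v → flatten (unflatten n v) ≡ v
  flatten-unflatten zero    []                = refl
  flatten-unflatten (suc n) (a ∷ b ∷ c ∷ v) = cong (λ u → a ∷ b ∷ c ∷ u) (flatten-unflatten n v)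

  unflatten-flatten : (v : Blocks n) → unflatten n (flatten v) ≡ v
  unflatten-flatten []      = refl
  unflatten-flatten (x ∷ v) = cong (x ∷_) (unflatten-flatten v)

  flatten-⊞ : (u v : Blocks n) → flatten (u ⊞ᴮ v) ≡ flatten u ⊞ flatten v
  flatten-⊞ []      []      = refl
  flatten-⊞ (_ ∷ u) (_ ∷ v) = cong (λ w → _ ∷ _ ∷ _ ∷ w) (flatten-⊞ u v)

  -- One coordinate for `e`, three per block, then the tail, whose length `r` can absorb any surplus
  -- dimension.
  encode : Point n r → Vec F (suc (n * 3 + r))
  encode (t , e , v) = e ∷ (flatten v Vec.++ t)

  decode : ∀ n → Vec F (suc (n * 3 + r)) → Point n r
  decode n (e ∷ v) = drop (n * 3) v , e , unflatten n (take (n * 3) v)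

  encode-decode : ∀ n (v : Vec F (suc (n * 3 + r))) → encode (decode n v) ≡ v
  encode-decode n (e ∷ v) = cong (e ∷_)
    (trans (cong (Vec._++ drop (n * 3) v) (flatten-unflatten n (take (n * 3) v)))
           (Vec.take++drop≡id (n * 3) v))

  decode-encode : (x : Point n r) → decode n (encode x) ≡ x
  decode-encode {n} (t , e , v)
    with take≡ , drop≡ ← Vec.++-injective (take (n * 3) (flatten v Vec.++ t)) (flatten v)
                           (Vec.take++drop≡id (n * 3) (flatten v Vec.++ t)) =
    cong₂ _,_ drop≡ (cong (e ,_) (trans (cong (unflatten n) take≡) (unflatten-flatten v)))

  encode-⊞ : (x y : Point n r) → encode (x ⊞ᴾ y) ≡ encode x ⊞ encode y
  encode-⊞ (t , e , u) (t′ , f , v) = cong (e ⊕ f ∷_)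
    (trans (cong (Vec._++ (t ⊞ t′)) (flatten-⊞ u v))
           (sym (Vec.zipWith-++ _⊕_ (flatten u) t (flatten v) t′)))

  decode-⊞ : ∀ n (u v : Vec F (suc (n * 3 + r))) → decode n (u ⊞ v) ≡ decode n u ⊞ᴾ decode n v
  decode-⊞ n u v = begin
    decode n (u ⊞ v)
      ≡⟨ cong₂ (λ x y → decode n (x ⊞ y)) (encode-decode n u) (encode-decode n v) ⟨
    decode n (encode (decode n u) ⊞ encode (decode n v)) ≡⟨ cong (decode n) (encode-⊞ (decode n u) (decode n v)) ⟨
    decode n (encode (decode n u ⊞ᴾ decode n v))         ≡⟨ decode-encode (decode n u ⊞ᴾ decode n v) ⟩
    decode n u ⊞ᴾ decode n v                             ∎
    where open ≡-Reasoning

  -- Enumeration of the points and cardinalities.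

  tails : ∀ r → List (Vec F r)
  tails = allVec (allFin p)

  blocks : List Block
  blocks = cartesianProduct (cartesianProduct (allFin p) (allFin p)) (allFin p)

  frames : ∀ n → List (F × Blocks n)
  frames n = cartesianProduct (allFin p) (allVec blocks n)

  points : ∀ n r → List (Point n r)
  points n r = cartesianProduct (tails r) (frames n)

  frames-unique : ∀ n → Unique (frames n)
  frames-unique n = Unique.cartesianProduct⁺ F! (allVec-unique blocks! n)
    where
    F! : Unique (allFin p)
    F! = Unique.allFin⁺ p
    blocks! : Unique blocks
    blocks! = Unique.cartesianProduct⁺ (Unique.cartesianProduct⁺ F! F!) F!

  frames-complete : (y : F × Blocks n) → y ∈ frames n
  frames-complete (e , v) = ∈-cartesianProduct⁺ (∈-allFin e) (allVec-complete blocks-complete v)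
    where
    blocks-complete : ∀ x → x ∈ blocks
    blocks-complete ((a , b) , c) =
      ∈-cartesianProduct⁺ (∈-cartesianProduct⁺ (∈-allFin a) (∈-allFin b)) (∈-allFin c)

  tails-unique : ∀ r → Unique (tails r)
  tails-unique = allVec-unique (Unique.allFin⁺ p)

  cardinality : {P : Pred (Vec F (suc (n * 3 + r))) 0ℓ} {Q : Pred (Point n r) 0ℓ} (Q? : Decidable Q) →
                (∀ v → P v ⇔ Q (decode n v)) →
                HasCardinality (setoid (Vec F (suc (n * 3 + r)))) P (count Q? (points n r))
  cardinality {n} {r} {P} {Q} Q? P⇔Q =
    map encode (filter Q? (points n r)) ,
    Unique.map⁺ encode-injective
      (Unique.filter⁺ Q? (Unique.cartesianProduct⁺ (tails-unique r) (frames-unique n))) ,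
    (λ v → mk⇔ (to v) (from v)) ,
    length-map encode (filter Q? (points n r))
    where
    encode-injective : {x y : Point n r} → encode x ≡ encode y → x ≡ y
    encode-injective {x} {y} eq =
      trans (sym (decode-encode x)) (trans (cong (decode n) eq) (decode-encode y))
    ∈points : ∀ x → x ∈ points n r
    ∈points (t , y) = ∈-cartesianProduct⁺ (allVec-complete ∈-allFin t) (frames-complete y)
    to : ∀ v → P v → v ∈ map encode (filter Q? (points n r))
    to v Pv = subst (_∈ map encode (filter Q? (points n r))) (encode-decode n v)
      (∈-map⁺ encode (∈-filter⁺ Q? (∈points (decode n v)) (Equivalence.to (P⇔Q v) Pv)))
    from : ∀ v → v ∈ map encode (filter Q? (points n r)) → P v
    from v v∈ with x , x∈ , refl ← ∈-map⁻ encode v∈ = Equivalence.from (P⇔Q (encode x))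
      (subst Q (sym (decode-encode x)) (proj₂ (∈-filter⁻ Q? {xs = points n r} x∈)))

  -- Counting the points removed by holes.

  -- As `e = 1` adds one to the weight, these points have total weight `suc i` and are missing from
  -- the `suc i`-fold sumset.
  FrameHole : Maybe (Vec Bool n) → ℕ → F × Blocks n → Set
  FrameHole {n} τ i (e , v) = e ≡ suc zero × weight n v ≡ i × HoleOf τ v

  frameHole? : (τ : Maybe (Vec Bool n)) → ∀ i → Decidable (FrameHole τ i)
  frameHole? {n} τ i (e , v) = (e Fin.≟ suc zero) ×-dec ((weight n v ℕ.≟ i) ×-dec holeOf? τ v)

  holes : Maybe (Vec Bool n) → ℕ → ℕ
  holes {n} τ i = count (frameHole? τ i) (frames n)

  holes-nothing : ∀ n i → holes {n} nothing i ≡ 0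
  holes-nothing n i = count-none (frameHole? nothing i) (λ _ ()) (frames n)

  module _ {n r} (ψ : Vec F r → Maybe (Vec Bool n)) (ψ-0 : ψ 0ⱽ ≡ nothing) where

    open Filtration ψ ψ-0

    private
      G = [ℤ/ p ]^ suc (n * 3 + r)
      module U = Filtration {n} {r} (const nothing) refl

    sumset⇔R : ∀ h v → Sumset G h (R 1 ∘ decode n) v ⇔ R h (decode n v)
    sumset⇔R = sumset-filtration G (λ h v → R h (decode n v))
      (λ { refl → id })
      (subst (R 0) (sym (trans (cong (decode n) (sym encode-origin)) (decode-encode origin))) (R-origin 0))
      (λ {v} Rv → trans (sym (encode-decode n v)) (trans (cong encode (R-zero _ Rv)) encode-origin))
      (λ {h} {x} {y} Rx Ry → subst (R (suc h)) (sym (decode-⊞ n x y)) (R-⊞ 1 h _ _ Rx Ry))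
      split
      where
      encode-origin : encode origin ≡ 0ⱽ
      encode-origin = cong (zero ∷_) (flatten-0ᴮ n)
        where
        flatten-0ᴮ : ∀ n → flatten (0ᴮ {n}) Vec.++ 0ⱽ ≡ 0ⱽ
        flatten-0ᴮ zero    = refl
        flatten-0ᴮ (suc n) = cong (λ v → zero ∷ zero ∷ zero ∷ v) (flatten-0ᴮ n)
      split : ∀ {h v} → R (suc h) (decode n v) →
              ∃[ u ] ∃[ w ] R 1 (decode n u) × R h (decode n w) × v ≡ u ⊞ w
      split {h} {v} Rv with y , z , Ry , Rz , eq ← R-split h (decode n v) Rv =
        encode y , encode z ,
        subst (R 1) (sym (decode-encode y)) Ry , subst (R h) (sym (decode-encode z)) Rz ,
        trans (sym (encode-decode n v)) (trans (cong encode eq) (encode-⊞ y z))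

    sumset-cardinality : ∀ h → HasCardinality (AbelianGroup.setoid G) (Sumset G h (R 1 ∘ decode n))
                                 (count (R? h) (points n r))
    sumset-cardinality h = cardinality (R? h) (sumset⇔R h)

    Missing : ℕ → Point n r → Set
    Missing i (t , y) = FrameHole (ψ t) i y

    missing? : ∀ i → Decidable (Missing i)
    missing? i (t , y) = frameHole? (ψ t) i y

    -- `U` is the filtration without holes. The two differ only at points of total weight `suc i`
    -- with `e = 1`, and these are counted tail by tail.
    count-missing : ∀ i → count (U.R? (suc i)) (points n r) ≡
                          count (R? (suc i)) (points n r) + sum (map (λ t → holes (ψ t) i) (tails r))
    count-missing i = trans
      (count-⊎ (U.R? (suc i)) (R? (suc i)) (missing? i) cases weaken whole exclusive (points n r))
      (cong (λ k → count (R? (suc i)) (points n r) + k) (count-cartesianProduct (missing? i) (tails r) (frames n)))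
      where
      cases : ∀ x → U.R (suc i) x → R (suc i) x ⊎ Missing i x
      cases x                     (inj₁ lt)       = inj₁ (inj₁ lt)
      cases (t , zero , v)        (inj₂ (eq , ε)) = inj₁ (inj₂ (eq , ε))
      cases (t , suc (suc _) , v) (inj₂ (eq , _)) = inj₁ (inj₂ (eq , tt))
      cases (t , suc zero , v)    (inj₂ (eq , _)) with holeOf? (ψ t) v
      ... | yes hole = inj₂ (refl , ℕ.suc-injective eq , hole)
      ... | no ¬hole = inj₁ (inj₂ (eq , ¬hole))
      weaken : ∀ x → R (suc i) x → U.R (suc i) x
      weaken x                     (inj₁ lt)       = inj₁ lt
      weaken (t , zero , v)        (inj₂ (eq , ε)) = inj₂ (eq , ε)
      weaken (t , suc zero , v)    (inj₂ (eq , _)) = inj₂ (eq , id)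
      weaken (t , suc (suc _) , v) (inj₂ (eq , _)) = inj₂ (eq , tt)
      whole : ∀ x → Missing i x → U.R (suc i) x
      whole (t , _ , v) (refl , eq , _) = inj₂ (cong suc eq , id)
      exclusive : ∀ x → R (suc i) x → ¬ Missing i x
      exclusive (t , _ , v) (inj₁ lt)           (refl , eq , hole) = ℕ.<-irrefl (cong suc eq) lt
      exclusive (t , _ , v) (inj₂ (_ , ¬hole)) (refl , eq , hole) = ¬hole hole

  -- The hole types and their unitriangular counts.

  prefix : ∀ n → ℕ → Vec Bool n
  prefix zero    _       = []
  prefix (suc n) zero    = false ∷ prefix n zero
  prefix (suc n) (suc j) = true ∷ prefix n j

  apex : ∀ n → ℕ → Blocks n
  apex zero    _       = []
  apex (suc n) zero    = (0ᴸ , zero) ∷ apex n zero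
  apex (suc n) (suc j) = (0ᴸ , suc zero) ∷ apex n j

  hole-apex : ∀ n j → Hole (prefix n j) (apex n j)
  hole-apex zero    _       = tt
  hole-apex (suc n) zero    = refl , hole-apex n zero
  hole-apex (suc n) (suc j) = refl , hole-apex n j

  weight-apex : ∀ n j → j ≤ n → weight n (apex n j) ≡ j
  weight-apex zero    zero    _         = refl
  weight-apex (suc n) zero    _         = weight-apex n zero z≤n
  weight-apex (suc n) (suc j) (s≤s j≤n) = cong suc (weight-apex n j j≤n)

  -- A `false` factor admits only the marker 0, and there are at most `j` factors `true`.
  hole-weight-≤ : ∀ n j v → Hole (prefix n j) v → weight n v ≤ j
  hole-weight-≤ zero    j       []                   _       = z≤n
  hole-weight-≤ (suc n) zero    ((_ , zero) ∷ v)     (_ , h) = hole-weight-≤ n zero v h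
  hole-weight-≤ (suc n) (suc j) ((_ , zero) ∷ v)     (_ , h) = ℕ.m≤n⇒m≤1+n (hole-weight-≤ n j v h)
  hole-weight-≤ (suc n) (suc j) ((_ , suc zero) ∷ v) (_ , h) = s≤s (hole-weight-≤ n j v h)

  -- Weight `j` forces a nonzero marker in each `true` factor, where the hole leaves only `ℓ = 0`
  -- with marker 1; a `false` factor leaves only the zero block.
  hole-apex-unique : ∀ n j v → Hole (prefix n j) v → weight n v ≡ j → v ≡ apex n j
  hole-apex-unique zero    j       []                   _          _  = refl
  hole-apex-unique (suc n) zero    ((_ , zero) ∷ v)     (refl , h) eq = cong (_ ∷_) (hole-apex-unique n zero v h eq)
  hole-apex-unique (suc n) (suc j) ((_ , zero) ∷ v)     (_ , h)    eq =
    contradiction eq (ℕ.<⇒≢ (s≤s (hole-weight-≤ n j v h)))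
  hole-apex-unique (suc n) (suc j) ((_ , suc zero) ∷ v) (refl , h) eq =
    cong (_ ∷_) (hole-apex-unique n j v h (ℕ.suc-injective eq))

  holes-above : ∀ n {i j} → j < i → holes (just (prefix n j)) i ≡ 0
  holes-above n {i} {j} j<i = count-none (frameHole? (just (prefix n j)) i) none (frames n)
    where
    none : ∀ y → ¬ FrameHole (just (prefix n j)) i y
    none (_ , v) (_ , refl , h) = ℕ.<⇒≱ j<i (hole-weight-≤ n j v h)

  holes-diagonal : ∀ n {j} → j ≤ n → holes (just (prefix n j)) j ≡ 1
  holes-diagonal n {j} j≤n =
    count-single (frameHole? (just (prefix n j)) j) {suc zero , apex n j}
      (refl , weight-apex n j j≤n , hole-apex n j)
      (λ { (_ , v) (refl , eq , h) → cong (suc zero ,_) (hole-apex-unique n j v h eq) })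
      (frames-unique n) (frames-complete _)

  -- Placing the holes at distinct tails.

  unit : Vec F (suc r)
  unit = suc zero ∷ 0ⱽ

  -- Entry k of the list is found at the k-th standard unit vector.
  address : List A → Vec F r → Maybe A
  address []       _              = nothing
  address (_ ∷ _)  []             = nothing
  address (_ ∷ xs) (zero ∷ t)     = address xs t
  address (x ∷ _)  t@(suc _ ∷ _) with Vec.≡-dec Fin._≟_ t unit
  ... | yes _ = just x
  ... | no  _ = nothing

  address-0 : (xs : List A) → ∀ r → address xs (0ⱽ {r}) ≡ nothing
  address-0 []       r       = refl
  address-0 (_ ∷ _)  zero    = refl
  address-0 (_ ∷ xs) (suc r) = address-0 xs r

  module _ (g : Maybe A → ℕ) (g-nothing : g nothing ≡ 0) where

    address-unit : ∀ x xs → g (address (x ∷ xs) (unit {r})) ≡ g (just x)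
    address-unit {r} x xs with Vec.≡-dec Fin._≟_ (unit {r}) unit
    ... | yes _ = refl
    ... | no ≢  = contradiction refl ≢

    address-¬unit : ∀ x xs i (t : Vec F r) → suc i ∷ t ≢ unit → g (address (x ∷ xs) (suc i ∷ t)) ≡ 0
    address-¬unit x xs i t t≢ with Vec.≡-dec Fin._≟_ (suc i ∷ t) unit
    ... | yes eq = contradiction eq t≢
    ... | no  _  = g-nothing

    -- Tails starting with 0 carry the rest of the list by induction; among the others only `unit`
    -- carries an entry, namely `x`.
    sum-address : ∀ xs r → length xs ≤ r → sum (map (g ∘ address xs) (tails r)) ≡ sum (map (g ∘ just) xs)
    sum-address []       r       _       = sum-zero _ (tails r) (λ _ _ → g-nothing)
    sum-address (x ∷ xs) (suc r) (s≤s l) = begin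
      sum (map f (tails (suc r)))                             ≡⟨ sum-cartesianProductWith _∷_ f (allFin p) (tails r) ⟩
      -- `allFin p` computes to `zero ∷ tabulate suc`.
      sum (map (f ∘ (zero ∷_)) (tails r)) + sum (map fibre (tabulate suc))
                                                              ≡⟨ cong₂ _+_ (sum-address xs r l) rest ⟩
      sum (map (g ∘ just) xs) + g (just x)                    ≡⟨ ℕ.+-comm _ (g (just x)) ⟩
      sum (map (g ∘ just) (x ∷ xs))                           ∎
      where
      open ≡-Reasoning
      f = g ∘ address (x ∷ xs)
      fibre : F → ℕ
      fibre c = sum (map (f ∘ (c ∷_)) (tails r))
      fibre-one : fibre (suc zero) ≡ g (just x)
      fibre-one = trans
        (sum-single (f ∘ (suc zero ∷_)) (tails-unique r) (allVec-complete ∈-allFin 0ⱽ)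
          (λ t _ t≢0 → address-¬unit x xs zero t (t≢0 ∘ Vec.∷-injectiveʳ)))
        (address-unit {r} x xs)
      fibre-other : ∀ c → c ∈ tabulate suc → c ≢ suc zero → fibre c ≡ 0
      fibre-other c c∈ c≢1 with i , refl ← ∈-tabulate⁻ {f = suc} c∈ =
        sum-zero _ (tails r) (λ t _ → address-¬unit x xs i t (c≢1 ∘ Vec.∷-injectiveˡ))
      rest : sum (map fibre (tabulate suc)) ≡ g (just x)
      rest = trans (sum-single fibre (Unique.tabulate⁺ Fin.suc-injective) (here refl) fibre-other) fibre-one

  -- The sets with prescribed holes.

  -- The coefficient matrix of the system, unitriangular by `holes-above` and `holes-diagonal`.
  prefixHoles : ℕ → ℕ → ℕ → ℕ
  prefixHoles n j = holes (just (prefix n j))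

  module _ (n r : ℕ) (js : List ℕ) (js≤r : length js ≤ r) where

    private
      prefixes : List (Vec Bool n)
      prefixes = map (prefix n) js

      ψ : Vec F r → Maybe (Vec Bool n)
      ψ = address prefixes

    open Filtration ψ (address-0 prefixes r)

    generators : Pred (Vec F (suc (n * 3 + r))) 0ℓ
    generators = R 1 ∘ decode n

    -- The left side of the last equation does not depend on `js`, so it serves as the common total
    -- for both sets.
    generators-cardinality : ∀ i → ∃[ k ]
      HasCardinality (AbelianGroup.setoid ([ℤ/ p ]^ suc (n * 3 + r)))
        (Sumset ([ℤ/ p ]^ suc (n * 3 + r)) (suc i) generators) k ×
      count (Filtration.R? {n} {r} (const nothing) refl (suc i)) (points n r) ≡
        k + combination (prefixHoles n) js i
    generators-cardinality i =
      count (R? (suc i)) (points n r) ,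
      sumset-cardinality ψ (address-0 prefixes r) (suc i) ,
      trans (count-missing ψ (address-0 prefixes r) i) (cong (λ s → count (R? (suc i)) (points n r) + s)
        (trans (sum-address (λ τ → holes τ i) (holes-nothing n i) prefixes r
                 (subst (_≤ r) (sym (length-map (prefix n) js)) js≤r))
               (cong sum (sym (map-∘ js)))))

  -- A has the holes listed in ks and B those in js, since holes make the sumset smaller.
  realise : ∀ {N} n r js ks → length js ≤ r → length ks ≤ r → suc (n * 3 + r) ≡ N →
    let G = [ℤ/ p ]^ N in
    Σ[ A ∈ Pred (AbelianGroup.Carrier G) 0ℓ ] Σ[ B ∈ Pred (AbelianGroup.Carrier G) 0ℓ ]
    (∀ i → ∃[ k ] ∃[ l ]
      HasCardinality (AbelianGroup.setoid G) (Sumset G (suc i) A) k ×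
      HasCardinality (AbelianGroup.setoid G) (Sumset G (suc i) B) l ×
      + k - + l ≡ + combination (prefixHoles n) js i - + combination (prefixHoles n) ks i)
  realise n r js ks js≤r ks≤r refl =
    generators n r ks ks≤r , generators n r js js≤r , λ i →
      let k , |A|≡k , eqA = generators-cardinality n r ks ks≤r i
          l , |B|≡l , eqB = generators-cardinality n r js js≤r i
      in k , l , |A|≡k , |B|≡l , ⊖-of-complements k _ l _ eqA eqB

-- Choice of the dimension and conclusion.

-- The linear system has targets indexed by ℕ; only those below `H` are solved for.
extension : ∀ {H} → (Fin H → ℤ) → ℕ → ℤ
extension {H} m i with i ℕ.<? H
... | yes i<H = m (fromℕ< i<H)
... | no  _   = + 0

extension-toℕ : ∀ {H} (m : Fin H → ℤ) i → extension m (toℕ i) ≡ m i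
extension-toℕ {H} m i with toℕ i ℕ.<? H
... | yes i<H = cong m (Fin.fromℕ<-toℕ i i<H)
... | no  i≮H = contradiction (Fin.toℕ<n i) i≮H

theorem1p3 : (p : ℕ) (p-prime : Prime p) (H : ℕ) .{{_ : NonZero H}} (m : Fin H → ℤ) →
    ∃[ N₀ ] ((N : ℕ) .{{_ : NonZero N}} → N₀ ≤ N →
    let G = ([ℤ/ p ]^ N) {{prime⇒nonZero p-prime}} in
    Σ[ A ∈ Pred (AbelianGroup.Carrier G) 0ℓ ] Σ[ B ∈ Pred (AbelianGroup.Carrier G) 0ℓ ]
    ((i : Fin H) → ∃[ k ] ∃[ l ]
    HasCardinality (AbelianGroup.setoid G) (Sumset G (suc (toℕ i)) A) k ×
    HasCardinality (AbelianGroup.setoid G) (Sumset G (suc (toℕ i)) B) l ×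
    + k - + l ≡ m i))
theorem1p3 zero          p-prime = contradiction p-prime λ ()
theorem1p3 (suc zero)    p-prime = contradiction p-prime λ ()
theorem1p3 (suc (suc q)) p-prime H m
  -- `H` blocks provide all hole types `j < H`. The index `i` stands for `h = i + 1`.
  with js , ks , _ , _ , solved ←
    unitriangular-solvable (Construction.prefixHoles q H) (Construction.holes-above q H)
      H (Construction.holes-diagonal q H ∘ ℕ.<⇒≤) (extension m)
  with s ← length js + length ks in s≡ =
  -- The tail part `s` is long enough to give every entry of either list its own unit vector.
  suc (H * 3 + s) , λ N N₀≤N →
    let o , eq = ℕ.m≤n⇒∃[o]m+o≡n N₀≤N
        js≤s = subst (length js ≤_) s≡ (ℕ.m≤m+n (length js) (length ks))
        ks≤s = subst (length ks ≤_) s≡ (ℕ.m≤n+m (length ks) (length js))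
        -- The surplus `o = N - N₀` only lengthens the tail; the blocks and the hole counts stay the
        -- same.
        A , B , sizes = Construction.realise q H (s + o) js ks
                          (ℕ.≤-trans js≤s (ℕ.m≤m+n s o)) (ℕ.≤-trans ks≤s (ℕ.m≤m+n s o))
                          (trans (cong suc (sym (ℕ.+-assoc (H * 3) s o))) eq)
    in A , B , λ i →
      let k , l , |A|≡k , |B|≡l , k-l≡ = sizes (toℕ i)
      in k , l , |A|≡k , |B|≡l , trans k-l≡ (trans (solved (toℕ i) (Fin.toℕ<n i)) (extension-toℕ m i))
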